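{- Let $w$ be a binary word and let $l(w)$ be the length of the run sequence of $w$. If all elements of $\mathtt{BR}(w)$ are rich, then $2\le l(w)\le 8$.
   Context: A binary word is a word over a two-letter alphabet $\{a,b\}$ in which both letters occur. Every non-empty word has a unique run-length encoding $w=c_1^{n_1}c_2^{n_2}\cdots c_k^{n_k}$ with letters $c_i\neq c_{i+1}$ and $n_i\ge 1$; $(n_1,\dots,n_k)$ is the run sequence and $l(w)=k$ its length. For $w\in\Sigma^+$, $\mathtt{BR}(w)=\{B_tB_{t-1}\cdots B_1 : w=B_1B_2\cdots B_t,\ t\ge 1,\ B_i\in\Sigma^+\}$. A word $w$ is rich if it has exactly $|w|$ distinct non-empty palindromic factors (the maximum possible). -}

module Defs where

open import Data.Nat using (ℕ; zero; suc)
open import Data.List using (List; []; _∷_; length; reverse; concat; filter; deduplicate; _++_; map)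
open import Data.List.Relation.Unary.All using (All)
open import Data.List.Membership.Propositional using (_∈_)
open import Data.Product using (Σ; ∃; _×_; _,_)
open import Relation.Binary.PropositionalEquality using (_≡_; _≢_)
open import Relation.Binary.Definitions using (DecidableEquality)
open import Relation.Nullary using (yes; no)
open import Data.List.Relation.Binary.Pointwise using () renaming (decidable to ptw-dec)
import Data.List.Properties as LP

data Letter : Set where
  a b : Letter

_≟L_ : DecidableEquality Letter
a ≟L a = yes _≡_.refl
a ≟L b = no λ ()
b ≟L a = no λ ()
b ≟L b = yes _≡_.refl

Word : Set
Word = List Letter

_≟W_ : DecidableEquality Word
_≟W_ = LP.≡-dec _≟L_

Binary : Word → Set
Binary w = (a ∈ w) × (b ∈ w)

runsAfter : Letter → Word → ℕ
runsAfter x [] = suc zero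
runsAfter x (y ∷ w) with x ≟L y
... | yes _ = runsAfter y w
... | no _ = suc (runsAfter y w)

runLength : Word → ℕ
runLength [] = zero
runLength (x ∷ w) = runsAfter x w

nePrefixes : Word → List Word
nePrefixes [] = []
nePrefixes (x ∷ w) = (x ∷ []) ∷ map (x ∷_) (nePrefixes w)

neFactors : Word → List Word
neFactors [] = []
neFactors (x ∷ w) = nePrefixes (x ∷ w) ++ neFactors w

IsPalindrome : Word → Set
IsPalindrome u = reverse u ≡ u

palFactors : Word → List Word
palFactors w = deduplicate _≟W_ (filter (λ u → reverse u ≟W u) (neFactors w))

Rich : Word → Set
Rich w = length (palFactors w) ≡ length w

NonEmpty : Word → Set
NonEmpty u = u ≢ []

InBR : Word → Word → Set
InBR w v = Σ (List Word) λ Bs →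
  (Bs ≢ []) × All NonEmpty Bs × (concat Bs ≡ w) × (v ≡ concat (reverse Bs))

{-# OPTIONS --safe #-}
-- Among the palindromic prefixes of xw only the longest can fail to occur in w,
-- so every factor of a rich word is rich; and cc dⁱ c dʲ cc with i ≠ j is not
-- rich, since its prefix cc returns without closing a palindrome.
-- A word with at least nine runs has a factor
--   c d^Q₁ c^P₂ d^Q₂ c^P₃ d^Q₃ c^P₄ d^Q₄ c,
-- and block reversal, by merging runs, produces cc dⁱ c dʲ cc with (i , j) equal to
--   (Q₄ + Q₃ , Q₂ + Q₁) or (Q₄ + Q₃ − 1 , 1 + Q₂ + Q₁)  when P₃ = 1,
--   (Q₄ + Q₃ , Q₂) or (Q₃ , Q₂ + Q₁)                    when P₃ ≥ 2;
-- in each line at least one of the two pairs has i ≠ j.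
module Submission where

open import Defs
open import Data.List using (List; []; _∷_; _∷ʳ_; _++_; concat; filter; length; replicate; reverse)
open import Data.List.Membership.Propositional using (_∈_)
open import Data.List.Membership.Propositional.Properties using (∈-∃++; ∈-++⁺ˡ; ∈-++⁺ʳ; ∈-++⁻; ∈-map⁻; ∈-filter⁻; ∈-deduplicate⁻)
open import Data.List.Properties using (++-assoc; ++-identityʳ; concat-++; length-++; length-reverse; reverse-++; reverse-involutive; unfold-reverse; ∷-injective; ∷-injectiveʳ; ∷ʳ-injective)
open import Data.List.Relation.Binary.Subset.Propositional using (_⊆_)
open import Data.List.Relation.Unary.All using (All; []; _∷_)
import Data.List.Relation.Unary.All as All
open import Data.List.Relation.Unary.Any using (here; there)
open import Data.List.Relation.Unary.AllPairs using ([]; _∷_)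
open import Data.List.Relation.Unary.Unique.Propositional using (Unique)
open import Data.List.Relation.Unary.Unique.DecPropositional.Properties _≟W_ using (deduplicate-!)
open import Data.List.Reverse using (Reverse; reverseView; []; _∶_∶ʳ_)
open import Data.Nat using (ℕ; zero; suc; _+_; _≤_; _<_; z≤n; s≤s; s≤s⁻¹; _≟_)
open import Data.Nat.Properties using (+-identityʳ; +-suc; ≤-refl; ≤-reflexive; ≤-trans; <-asym; <-irrefl; m≤m+n; m≤n+m; suc-injective; ≮⇒≥; module ≤-Reasoning)
open import Data.Product using (∃; ∃₂; _×_; _,_; proj₁)
open import Data.Sum using (inj₁; inj₂)
open import Relation.Binary.PropositionalEquality using (_≡_; _≢_; refl; sym; ≢-sym; trans; cong; cong₂; subst; module ≡-Reasoning)
open import Relation.Nullary using (¬_; yes; no; contradiction)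
open import Relation.Unary using (Decidable)

private
  variable
    A : Set
    q w : Word

-- Counting in lists and longest prefixes

⊆⇒length≤ : {xs ys : List A} → Unique xs → xs ⊆ ys → length xs ≤ length ys
⊆⇒length≤ [] _ = z≤n
⊆⇒length≤ {xs = x ∷ xs} (x∉xs ∷ xs!) sub with ∈-∃++ (sub (here refl))
... | as , bs , refl = begin
  suc (length xs)             ≤⟨ s≤s (⊆⇒length≤ xs! remove) ⟩
  suc (length (as ++ bs))     ≡⟨ cong suc (length-++ as) ⟩
  suc (length as + length bs) ≡⟨ +-suc (length as) (length bs) ⟨
  length as + suc (length bs) ≡⟨ length-++ as ⟨
  length (as ++ x ∷ bs)       ∎
  where
  open ≤-Reasoning
  remove : xs ⊆ as ++ bs
  remove y∈xs with ∈-++⁻ as (sub (there y∈xs))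
  ... | inj₁ y∈as         = ∈-++⁺ˡ y∈as
  ... | inj₂ (here refl)  = contradiction refl (All.lookup x∉xs y∈xs)
  ... | inj₂ (there y∈bs) = ∈-++⁺ʳ as y∈bs

-- Maximality is phrased through prefixes, not lengths, so that every competitor `q` comes with the
-- remainder `s` completing it to `p`.
longestPrefix : {P : List A → Set} → Decidable P → P [] → (z : List A) →
  ∃₂ λ p r → P p × p ++ r ≡ z × (∀ q t → P q → q ++ t ≡ z → ∃ λ s → q ++ s ≡ p)
longestPrefix {A = A} {P = P} P? P[] z = go (reverseView z)
  where
  go : {z : List A} → Reverse z →
    ∃₂ λ p r → P p × p ++ r ≡ z × (∀ q t → P q → q ++ t ≡ z → ∃ λ s → q ++ s ≡ p)
  go [] = [] , [] , P[] , refl , λ q t _ eq → t , eq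
  go (z ∶ rz ∶ʳ x) with P? (z ∷ʳ x)
  ... | yes Pz = z ∷ʳ x , [] , Pz , ++-identityʳ _ , λ q t _ eq → t , eq
  ... | no ¬Pz with go rz
  ...   | p , r , Pp , refl , longest = p , r ∷ʳ x , Pp , sym (++-assoc p r _) , longest′
    where
    longest′ : ∀ q t → P q → q ++ t ≡ (p ++ r) ∷ʳ x → ∃ λ s → q ++ s ≡ p
    longest′ q t Pq eq with reverseView t
    ... | []           = contradiction (subst P (trans (sym (++-identityʳ q)) eq) Pq) ¬Pz
    ... | t′ ∶ _ ∶ʳ y = longest q t′ Pq
          (proj₁ (∷ʳ-injective (q ++ t′) (p ++ r) (trans (++-assoc q t′ _) eq)))

-- Palindromic factors

Factor : Word → Word → Set
Factor q w = ∃₂ λ s t → s ++ q ++ t ≡ w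

-- `L` may repeat words or contain extra ones; its length is then an upper bound for the number of
-- palindromic factors, which suffices to refute richness.
Covers : Word → List Word → Set
Covers w L = ∀ {q} → NonEmpty q → IsPalindrome q → Factor q w → q ∈ L

Defective : Word → Set
Defective w = ∃ λ L → Covers w L × length L < length w

∈-nePrefixes⁻ : q ∈ nePrefixes w → NonEmpty q × ∃ λ t → q ++ t ≡ w
∈-nePrefixes⁻ {w = x ∷ w} (here refl) = (λ ()) , w , refl
∈-nePrefixes⁻ {w = x ∷ w} (there q∈) with ∈-map⁻ (x ∷_) q∈
... | q′ , q′∈ , refl with ∈-nePrefixes⁻ q′∈
...   | _ , t , eq = (λ ()) , t , cong (x ∷_) eq

∈-neFactors⁻ : q ∈ neFactors w → NonEmpty q × Factor q w
∈-neFactors⁻ {w = x ∷ w} q∈ with ∈-++⁻ (nePrefixes (x ∷ w)) q∈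
... | inj₁ q∈pre = let ne , t , eq = ∈-nePrefixes⁻ q∈pre in ne , [] , t , eq
... | inj₂ q∈fac = let ne , s , t , eq = ∈-neFactors⁻ q∈fac in ne , x ∷ s , t , cong (x ∷_) eq

defective⇒¬rich : Defective w → ¬ Rich w
defective⇒¬rich {w} (L , covers , L<w) rich =
  <-irrefl rich (≤-trans (s≤s (⊆⇒length≤ (deduplicate-! palindromes) sub)) L<w)
  where
  palindromes = filter (λ u → reverse u ≟W u) (neFactors w)
  sub : palFactors w ⊆ L
  sub q∈ =
    let q∈fac , pal = ∈-filter⁻ (λ u → reverse u ≟W u) {xs = neFactors w}
                        (∈-deduplicate⁻ _≟W_ palindromes q∈)
        ne , fac    = ∈-neFactors⁻ q∈fac
    in covers ne pal fac

-- Reversal fixes both palindromes and turns the prefix `p` into a suffix. This gives a palindromic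
-- prefix its second occurrence in `covers-∷`.
palindrome-border : ∀ p s → IsPalindrome (p ++ s) → IsPalindrome p → reverse s ++ p ≡ p ++ s
palindrome-border p s pal-ps pal-p = begin
  reverse s ++ p         ≡⟨ cong (reverse s ++_) pal-p ⟨
  reverse s ++ reverse p ≡⟨ reverse-++ p s ⟨
  reverse (p ++ s)       ≡⟨ pal-ps ⟩
  p ++ s                 ∎
  where open ≡-Reasoning

-- A palindrome new in `x ∷ w` is a prefix, and one shorter than the longest palindromic prefix `p`
-- reappears as a suffix of `p`, thus inside `w`.
covers-∷ : ∀ x {L} → Covers w L → ∃ λ p → Covers (x ∷ w) (p ∷ L)
covers-∷ {w} x {L} covers with longestPrefix (λ u → reverse u ≟W u) refl (x ∷ w)
... | p , r , pal-p , p++r≡ , longest = p , covers′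
  where
  covers′ : Covers (x ∷ w) (p ∷ L)
  covers′ ne pal (y ∷ s , t , eq) = there (covers ne pal (s , t , ∷-injectiveʳ eq))
  covers′ {q} ne pal ([] , t , eq) with longest q t pal eq
  -- The second copy of `q` stands behind `reverse s`; matching on that word exposes the letter to
  -- be cancelled against `x`.
  ... | s , refl with reverse s in rev-s
  ...   | [] = here (trans (sym (++-identityʳ q)) (cong (q ++_) (sym s≡[])))
    where
    s≡[] : s ≡ []
    s≡[] = trans (sym (reverse-involutive s)) (cong reverse rev-s)
  ...   | y ∷ s′ = there (covers ne pal (s′ , r , ∷-injectiveʳ occurs))
    where
    occurs : y ∷ s′ ++ q ++ r ≡ x ∷ w
    occurs = begin
      y ∷ s′ ++ q ++ r         ≡⟨ ++-assoc (y ∷ s′) q r ⟨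
      (y ∷ s′ ++ q) ++ r       ≡⟨ cong (λ z → (z ++ q) ++ r) rev-s ⟨
      (reverse s ++ q) ++ r    ≡⟨ cong (_++ r) (palindrome-border q s pal-p pal) ⟩
      (q ++ s) ++ r            ≡⟨ p++r≡ ⟩
      x ∷ w                    ∎
      where open ≡-Reasoning

-- Iterating `covers-∷` yields the classical bound of one palindrome per letter; a defect is a
-- saving relative to it.
covers-length : ∀ w → ∃ λ L → Covers w L × length L ≡ length w
covers-length [] = [] , none , refl
  where
  none : Covers [] []
  none {[]} ne _ _ = contradiction refl ne
  none {_ ∷ _} _ _ ([] , _ , ())
  none {_ ∷ _} _ _ (_ ∷ _ , _ , ())
covers-length (x ∷ w) =
  let L , covers , len = covers-length w
      p , covers′ = covers-∷ x covers
  in p ∷ L , covers′ , cong suc len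

defective-∷ : ∀ x → Defective w → Defective (x ∷ w)
defective-∷ x (L , covers , L<w) = let p , covers′ = covers-∷ x covers in p ∷ L , covers′ , s≤s L<w

defective-++ˡ : ∀ u → Defective w → Defective (u ++ w)
defective-++ˡ []      def = def
defective-++ˡ (x ∷ u) def = defective-∷ x (defective-++ˡ u def)

-- A word and its reversal have the same palindromic factors, so the same `L` serves. This carries
-- extension on the left over to the right.
defective-reverse : Defective w → Defective (reverse w)
defective-reverse {w} (L , covers , L<w) =
  L , covers′ , subst (length L <_) (sym (length-reverse w)) L<w
  where
  covers′ : Covers (reverse w) L
  covers′ {q} ne pal (s , t , eq) = covers ne pal (reverse t , reverse s , eq′)
    where
    open ≡-Reasoning
    eq′ : reverse t ++ q ++ reverse s ≡ w
    eq′ = begin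
      reverse t ++ q ++ reverse s           ≡⟨ cong (λ z → reverse t ++ z ++ reverse s) pal ⟨
      reverse t ++ reverse q ++ reverse s   ≡⟨ ++-assoc (reverse t) _ _ ⟨
      (reverse t ++ reverse q) ++ reverse s ≡⟨ cong (_++ reverse s) (reverse-++ q t) ⟨
      reverse (q ++ t) ++ reverse s         ≡⟨ reverse-++ s (q ++ t) ⟨
      reverse (s ++ q ++ t)                 ≡⟨ cong reverse eq ⟩
      reverse (reverse w)                   ≡⟨ reverse-involutive w ⟩
      w                                     ∎

defective-++ʳ : ∀ u → Defective w → Defective (w ++ u)
defective-++ʳ {w} u def = subst Defective eq
  (defective-reverse (defective-++ˡ (reverse u) (defective-reverse def)))
  where
  eq : reverse (reverse u ++ reverse w) ≡ w ++ u
  eq = trans (cong reverse (sym (reverse-++ w u))) (reverse-involutive (w ++ u))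

-- Block reversal

-- Lets block lists contain empty words, which arise from empty contexts and zero exponents.
dropEmpty : (Bs : List Word) → ∃ λ Cs → All NonEmpty Cs ×
  concat Cs ≡ concat Bs × concat (reverse Cs) ≡ concat (reverse Bs)
dropEmpty [] = [] , [] , refl , refl
dropEmpty (B ∷ Bs) with dropEmpty Bs
dropEmpty ([] ∷ Bs) | Cs , ne , eq , eqʳ = Cs , ne , eq , trans eqʳ (sym (begin
  concat (reverse ([] ∷ Bs))         ≡⟨ cong concat (unfold-reverse [] Bs) ⟩
  concat (reverse Bs ∷ʳ [])          ≡⟨ concat-++ (reverse Bs) _ ⟨
  concat (reverse Bs) ++ []          ≡⟨ ++-identityʳ _ ⟩
  concat (reverse Bs)                ∎))
  where open ≡-Reasoning
dropEmpty (B@(_ ∷ _) ∷ Bs) | Cs , ne , eq , eqʳ = B ∷ Cs , (λ ()) ∷ ne , cong (B ++_) eq , (begin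
  concat (reverse (B ∷ Cs))          ≡⟨ cong concat (unfold-reverse B Cs) ⟩
  concat (reverse Cs ∷ʳ B)           ≡⟨ concat-++ (reverse Cs) _ ⟨
  concat (reverse Cs) ++ B ++ []     ≡⟨ cong (_++ (B ++ [])) eqʳ ⟩
  concat (reverse Bs) ++ B ++ []     ≡⟨ concat-++ (reverse Bs) _ ⟩
  concat (reverse Bs ∷ʳ B)           ≡⟨ cong concat (unfold-reverse B Bs) ⟨
  concat (reverse (B ∷ Bs))          ∎)
  where open ≡-Reasoning

inBR : ∀ Bs → NonEmpty w → concat Bs ≡ w → InBR w (concat (reverse Bs))
inBR Bs w≢[] eq with dropEmpty Bs
... | Cs , ne , eqC , eqʳ = Cs , (λ { refl → w≢[] (trans (sym eq) (sym eqC)) }) , ne , trans eqC eq , sym eqʳ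

++-∷-nonEmpty : ∀ u {x z} → NonEmpty (u ++ x ∷ z)
++-∷-nonEmpty []      ()
++-∷-nonEmpty (_ ∷ _) ()

HasDefectiveBR : Word → Set
HasDefectiveBR w = ∃ λ v → InBR w v × Defective v

-- Powers of a letter

infix 8 _^_
_^_ : Letter → ℕ → Word
c ^ n = replicate n c

^-+ : ∀ c m n {z} → c ^ m ++ c ^ n ++ z ≡ c ^ (m + n) ++ z
^-+ c zero    n = refl
^-+ c (suc m) n = cong (c ∷_) (^-+ c m n)

^-shift : ∀ c n {z} → c ^ n ++ c ∷ z ≡ c ^ suc n ++ z
^-shift c zero    = refl
^-shift c (suc n) = cong (c ∷_) (^-shift c n)

reverse-^ : ∀ x n → reverse (x ^ n) ≡ x ^ n
reverse-^ x zero    = refl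
reverse-^ x (suc n) = begin
  reverse (x ∷ x ^ n)  ≡⟨ unfold-reverse x (x ^ n) ⟩
  reverse (x ^ n) ∷ʳ x ≡⟨ cong (_∷ʳ x) (reverse-^ x n) ⟩
  x ^ n ∷ʳ x           ≡⟨ ^-shift x n ⟩
  x ^ suc n ++ []      ≡⟨ ++-identityʳ _ ⟩
  x ^ suc n            ∎
  where open ≡-Reasoning

-- Returns to a square and merged runs

module Alternating (c d : Letter) (c≢d : c ≢ d) where

  SquareOnlyAtEnd : Word → Set
  SquareOnlyAtEnd z = ∀ s {t} → s ++ c ∷ c ∷ t ≡ z → t ≡ []

  squareOnlyAtEnd-cc : SquareOnlyAtEnd (c ∷ c ∷ [])
  squareOnlyAtEnd-cc [] refl = refl
  squareOnlyAtEnd-cc (_ ∷ []) ()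
  squareOnlyAtEnd-cc (_ ∷ _ ∷ []) ()
  squareOnlyAtEnd-cc (_ ∷ _ ∷ _ ∷ _) ()

  squareOnlyAtEnd-d^ : ∀ n {z} → SquareOnlyAtEnd z → SquareOnlyAtEnd (d ^ n ++ z)
  squareOnlyAtEnd-d^ zero    only = only
  squareOnlyAtEnd-d^ (suc n) only []      eq = contradiction (proj₁ (∷-injective eq)) c≢d
  squareOnlyAtEnd-d^ (suc n) only (_ ∷ s) eq = squareOnlyAtEnd-d^ n only s (∷-injectiveʳ eq)

  squareOnlyAtEnd-cd : ∀ {z} → SquareOnlyAtEnd (d ∷ z) → SquareOnlyAtEnd (c ∷ d ∷ z)
  squareOnlyAtEnd-cd only []      eq = contradiction (proj₁ (∷-injective (∷-injectiveʳ eq))) c≢d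
  squareOnlyAtEnd-cd only (_ ∷ s) eq = only s (∷-injectiveʳ eq)

  d^-cancel : ∀ i j {y z} → d ^ i ++ c ∷ y ≡ d ^ j ++ c ∷ z → i ≡ j
  d^-cancel zero    zero    eq = refl
  d^-cancel zero    (suc j) eq = contradiction (proj₁ (∷-injective eq)) c≢d
  d^-cancel (suc i) zero    eq = contradiction (sym (proj₁ (∷-injective eq))) c≢d
  d^-cancel (suc i) (suc j) eq = cong suc (d^-cancel i j (∷-injectiveʳ eq))

  -- For positive exponents this is a complete return to the square of `c`: the square occurs only
  -- at the two ends.
  squareReturn : ℕ → ℕ → Word
  squareReturn i j = c ∷ c ∷ d ^ i ++ c ∷ d ^ j ++ c ∷ c ∷ []

  reverse-squareReturn : ∀ i j → reverse (squareReturn i j) ≡ squareReturn j i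
  reverse-squareReturn i j = begin
    reverse (cc ++ d ^ i ++ c ∷ d ^ j ++ cc)
      ≡⟨ reverse-++ cc (d ^ i ++ c ∷ d ^ j ++ cc) ⟩
    reverse (d ^ i ++ c ∷ d ^ j ++ cc) ++ cc
      ≡⟨ cong (_++ cc) (reverse-++ (d ^ i) _) ⟩
    (reverse ((c ∷ d ^ j) ++ cc) ++ reverse (d ^ i)) ++ cc
      ≡⟨ cong (λ z → (z ++ reverse (d ^ i)) ++ cc) (reverse-++ (c ∷ d ^ j) cc) ⟩
    (c ∷ c ∷ reverse (c ∷ d ^ j) ++ reverse (d ^ i)) ++ cc
      ≡⟨ cong₂ (λ y z → (c ∷ c ∷ y ++ z) ++ cc)
           (trans (unfold-reverse c (d ^ j)) (cong (_∷ʳ c) (reverse-^ d j))) (reverse-^ d i) ⟩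
    c ∷ c ∷ (d ^ j ∷ʳ c ++ d ^ i) ++ cc
      ≡⟨ cong (λ z → c ∷ c ∷ z) (trans (++-assoc (d ^ j ∷ʳ c) (d ^ i) cc) (++-assoc (d ^ j) _ _)) ⟩
    squareReturn j i ∎
    where
    open ≡-Reasoning
    cc : Word
    cc = c ∷ c ∷ []

  -- The list for the word without its first letter already covers the whole word, as no palindromic
  -- prefix is new. The successors keep both runs of `d` non-empty, so the middle `c` creates no
  -- further square.
  squareReturn-defective : ∀ {i j} → i ≢ j → Defective (squareReturn (suc i) (suc j))
  squareReturn-defective {i} {j} i≢j with covers-length (c ∷ d ^ suc i ++ c ∷ d ^ suc j ++ c ∷ c ∷ [])
  ... | L , covers , len = L , covers′ , s≤s (≤-reflexive len)
    where
    only : SquareOnlyAtEnd (c ∷ d ^ suc i ++ c ∷ d ^ suc j ++ c ∷ c ∷ [])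
    only = squareOnlyAtEnd-cd (squareOnlyAtEnd-d^ (suc i) (squareOnlyAtEnd-cd
             (squareOnlyAtEnd-d^ (suc j) squareOnlyAtEnd-cc)))

    ¬pal : ¬ IsPalindrome (squareReturn (suc i) (suc j))
    ¬pal pal = i≢j (sym (suc-injective (d^-cancel (suc j) (suc i)
      (∷-injectiveʳ (∷-injectiveʳ (trans (sym (reverse-squareReturn (suc i) (suc j))) pal))))))

    covers′ : Covers (squareReturn (suc i) (suc j)) L
    covers′ ne pal (_ ∷ s , t , eq) = covers ne pal (s , t , ∷-injectiveʳ eq)
    covers′ {[]} ne _ _ = contradiction refl ne
    -- The one-letter prefix recurs as the second letter, the two-letter prefix at the end of the
    -- word.
    covers′ {_ ∷ []} ne pal ([] , t , refl) = covers ne pal ([] , _ , refl)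
    covers′ {_ ∷ _ ∷ []} ne pal ([] , t , refl) =
      covers ne pal (c ∷ d ^ suc i ++ c ∷ d ^ suc j , [] , cong (c ∷_) (++-assoc (d ^ suc i) _ _))
    -- A longer palindromic prefix q ends with cc, hence is the whole word.
    covers′ {q@(x ∷ y ∷ z ∷ q′)} ne pal ([] , t , eq) = contradiction (subst IsPalindrome q≡ pal) ¬pal
      where
      open ≡-Reasoning
      x≡c : x ≡ c
      x≡c = proj₁ (∷-injective eq)
      y≡c : y ≡ c
      y≡c = proj₁ (∷-injective (∷-injectiveʳ eq))
      q-ends : reverse (z ∷ q′) ++ c ∷ c ∷ [] ≡ q
      q-ends = begin
        reverse (z ∷ q′) ++ c ∷ c ∷ [] ≡⟨ cong₂ (λ x y → reverse (z ∷ q′) ++ y ∷ x ∷ []) x≡c y≡c ⟨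
        reverse (z ∷ q′) ++ y ∷ x ∷ [] ≡⟨ reverse-++ (x ∷ y ∷ []) (z ∷ q′) ⟨
        reverse q                      ≡⟨ pal ⟩
        q                              ∎
      -- As `q` has at least three letters, its final square starts beyond the first letter, hence
      -- in the tail to which `only` applies.
      t≡[] : t ≡ []
      t≡[] with reverse (z ∷ q′) in rev | trans (sym (++-assoc (reverse (z ∷ q′)) _ t)) (trans (cong (_++ t) q-ends) eq)
      ... | [] | _ = contradiction (trans (sym (length-reverse (z ∷ q′))) (cong length rev)) λ ()
      ... | _ ∷ s | eq′ = only s (∷-injectiveʳ eq′)
      q≡ : q ≡ squareReturn (suc i) (suc j)
      q≡ = trans (sym (++-identityʳ q)) (trans (cong (q ++_) (sym t≡[])) eq)

  -- Only the two inner letters of each outer run are used; the surplus powers join the contexts.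
  defective-run-pattern : ∀ Y m i j n X → i ≢ j →
    Defective (Y ++ c ^ (2 + m) ++ d ^ suc i ++ c ∷ d ^ suc j ++ c ^ (2 + n) ++ X)
  defective-run-pattern Y m i j n X i≢j = subst Defective eq
    (defective-++ˡ Y (defective-++ˡ (c ^ m) (defective-++ʳ (c ^ n ++ X) (squareReturn-defective i≢j))))
    where
    open ≡-Reasoning
    R = c ^ n ++ X
    eq : Y ++ c ^ m ++ squareReturn (suc i) (suc j) ++ R
       ≡ Y ++ c ^ (2 + m) ++ d ^ suc i ++ c ∷ d ^ suc j ++ c ^ (2 + n) ++ X
    eq = cong (Y ++_) (begin
      c ^ m ++ c ∷ c ∷ (d ^ suc i ++ c ∷ d ^ suc j ++ c ∷ c ∷ []) ++ R
        ≡⟨ trans (^-shift c m) (^-shift c (suc m)) ⟩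
      c ^ (2 + m) ++ (d ^ suc i ++ c ∷ d ^ suc j ++ c ∷ c ∷ []) ++ R
        ≡⟨ cong (c ^ (2 + m) ++_) (++-assoc (d ^ suc i) _ R) ⟩
      c ^ (2 + m) ++ d ^ suc i ++ c ∷ (d ^ suc j ++ c ∷ c ∷ []) ++ R
        ≡⟨ cong (λ z → c ^ (2 + m) ++ d ^ suc i ++ c ∷ z) (++-assoc (d ^ suc j) _ R) ⟩
      c ^ (2 + m) ++ d ^ suc i ++ c ∷ d ^ suc j ++ c ^ (2 + n) ++ X ∎)

  -- Reversal joins the two `c`-blocks on each side, and likewise the `d`-blocks. The block
  -- `c ∷ d ^ e` keeps `e` letters of the next run behind the middle `c`; `l` or `l′` is zero when
  -- that `c` is cut from the edge of a longer run. The hypothesis compares the merged `d`-runs,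
  -- each length less one.
  defectiveBR-merge : ∀ X n k n′ l e l′ m′ k′ m Y → k′ + l′ ≢ e + (l + k) →
    HasDefectiveBR (X ++ c ^ suc n ++ d ^ suc k ++ c ^ suc n′ ++ d ^ l ++ c ∷ d ^ e ++
                    d ^ l′ ++ c ^ suc m′ ++ d ^ suc k′ ++ c ^ suc m ++ Y)
  defectiveBR-merge X n k n′ l e l′ m′ k′ m Y i≢j =
    _ , inBR blocks (++-∷-nonEmpty X) concat≡ , subst Defective (sym reversed≡)
          (defective-run-pattern Y (m + m′) (k′ + l′) (e + (l + k)) (n′ + n) X i≢j)
    where
    open ≡-Reasoning
    blocks : List Word
    blocks = X ∷ c ^ suc n ∷ (d ^ suc k ++ c ^ suc n′) ∷ d ^ l ∷ (c ∷ d ^ e) ∷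
             d ^ l′ ∷ (c ^ suc m′ ++ d ^ suc k′) ∷ c ^ suc m ∷ Y ∷ []

    concat≡ : concat blocks ≡ X ++ c ^ suc n ++ d ^ suc k ++ c ^ suc n′ ++ d ^ l ++ c ∷ d ^ e ++
                              d ^ l′ ++ c ^ suc m′ ++ d ^ suc k′ ++ c ^ suc m ++ Y
    concat≡ = cong (λ z → X ++ c ^ suc n ++ z) (trans (++-assoc (d ^ suc k) (c ^ suc n′) _)
      (cong (λ z → d ^ suc k ++ c ^ suc n′ ++ d ^ l ++ c ∷ d ^ e ++ d ^ l′ ++ z)
        (trans (++-assoc (c ^ suc m′) (d ^ suc k′) _)
          (cong (λ z → c ^ suc m′ ++ d ^ suc k′ ++ c ^ suc m ++ z) (++-identityʳ Y)))))

    left≡ : ∀ z → c ^ suc m ++ (c ^ suc m′ ++ d ^ suc k′) ++ d ^ l′ ++ z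
                ≡ c ^ (2 + (m + m′)) ++ d ^ suc (k′ + l′) ++ z
    left≡ z = begin
      c ^ suc m ++ (c ^ suc m′ ++ d ^ suc k′) ++ d ^ l′ ++ z
        ≡⟨ cong (c ^ suc m ++_) (++-assoc (c ^ suc m′) (d ^ suc k′) _) ⟩
      c ^ suc m ++ c ^ suc m′ ++ d ^ suc k′ ++ d ^ l′ ++ z
        ≡⟨ ^-+ c (suc m) (suc m′) ⟩
      c ^ (suc m + suc m′) ++ d ^ suc k′ ++ d ^ l′ ++ z
        ≡⟨ cong₂ (λ p y → c ^ suc p ++ y) (+-suc m m′) (^-+ d (suc k′) l′) ⟩
      c ^ (2 + (m + m′)) ++ d ^ suc (k′ + l′) ++ z ∎

    right≡ : d ^ e ++ d ^ l ++ (d ^ suc k ++ c ^ suc n′) ++ c ^ suc n ++ X ++ []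
           ≡ d ^ suc (e + (l + k)) ++ c ^ (2 + (n′ + n)) ++ X
    right≡ = begin
      d ^ e ++ d ^ l ++ (d ^ suc k ++ c ^ suc n′) ++ c ^ suc n ++ X ++ []
        ≡⟨ cong (λ z → d ^ e ++ d ^ l ++ z) (++-assoc (d ^ suc k) (c ^ suc n′) _) ⟩
      d ^ e ++ d ^ l ++ d ^ suc k ++ c ^ suc n′ ++ c ^ suc n ++ X ++ []
        ≡⟨ cong (d ^ e ++_) (^-+ d l (suc k)) ⟩
      d ^ e ++ d ^ (l + suc k) ++ c ^ suc n′ ++ c ^ suc n ++ X ++ []
        ≡⟨ ^-+ d e (l + suc k) ⟩
      d ^ (e + (l + suc k)) ++ c ^ suc n′ ++ c ^ suc n ++ X ++ []
        ≡⟨ cong₂ (λ p z → d ^ p ++ z) (trans (cong (e +_) (+-suc l k)) (+-suc e (l + k)))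
             (^-+ c (suc n′) (suc n)) ⟩
      d ^ suc (e + (l + k)) ++ c ^ (suc n′ + suc n) ++ X ++ []
        ≡⟨ cong₂ (λ p z → d ^ suc (e + (l + k)) ++ c ^ suc p ++ z) (+-suc n′ n) (++-identityʳ X) ⟩
      d ^ suc (e + (l + k)) ++ c ^ (2 + (n′ + n)) ++ X ∎

    reversed≡ : concat (reverse blocks) ≡
      Y ++ c ^ (2 + (m + m′)) ++ d ^ suc (k′ + l′) ++ c ∷ d ^ suc (e + (l + k)) ++ c ^ (2 + (n′ + n)) ++ X
    reversed≡ = cong (Y ++_) (trans (left≡ _)
      (cong (λ z → c ^ (2 + (m + m′)) ++ d ^ suc (k′ + l′) ++ c ∷ z) right≡))

  -- The outer letters `c` are the inner ends of the first and ninth runs, the rest of which lies in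
  -- `X` and `Y`. The choice of the middle `c` depends on whether the third `c`-run is a single
  -- letter.
  defectiveBR-nineRuns : ∀ X q₁ p₂ q₂ p₃ q₃ p₄ q₄ Y →
    HasDefectiveBR (X ++ c ∷ d ^ suc q₁ ++ c ^ suc p₂ ++ d ^ suc q₂ ++ c ^ suc p₃ ++
                    d ^ suc q₃ ++ c ^ suc p₄ ++ d ^ suc q₄ ++ c ∷ Y)
  defectiveBR-nineRuns X q₁ p₂ q₂ zero q₃ p₄ q₄ Y with q₄ + suc q₃ ≟ suc q₂ + q₁
  ... | no i≢j = defectiveBR-merge X 0 q₁ p₂ (suc q₂) 0 (suc q₃) p₄ q₄ 0 Y i≢j
  -- Leaving one `d` behind the middle `c` shortens one merged run and lengthens the other, so equal
  -- lengths come to differ by two.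
  ... | yes eq = defectiveBR-merge X 0 q₁ p₂ (suc q₂) 1 q₃ p₄ q₄ 0 Y λ eq′ →
        <-asym (≤-reflexive (sym eq′)) (≤-reflexive (trans (sym (+-suc q₄ q₃)) eq))
  defectiveBR-nineRuns X q₁ p₂ q₂ (suc p₃) q₃ p₄ q₄ Y with q₄ + suc q₃ ≟ q₂
  -- The middle letter is the last `c` of the third `c`-run, so `l` is zero; the first `d`-run joins
  -- the left context.
  ... | no i≢j = subst HasDefectiveBR eq
        (defectiveBR-merge (X ++ c ∷ d ^ suc q₁) p₂ q₂ p₃ 0 0 (suc q₃) p₄ q₄ 0 Y i≢j)
    where
    eq : _ ≡ X ++ c ∷ d ^ suc q₁ ++ c ^ suc p₂ ++ d ^ suc q₂ ++ c ^ suc (suc p₃) ++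
             d ^ suc q₃ ++ c ^ suc p₄ ++ d ^ suc q₄ ++ c ∷ Y
    eq = trans (++-assoc X _ _)
      (cong (λ z → X ++ c ∷ d ^ suc q₁ ++ c ^ suc p₂ ++ d ^ suc q₂ ++ z) (^-shift c (suc p₃)))
  -- Now the middle letter is the first `c` of that run, and the last `d`-run joins the right
  -- context. By `eq`, `q₃` lies below `q₂`, which excludes equality.
  ... | yes eq = defectiveBR-merge X 0 q₁ p₂ (suc q₂) 0 0 p₃ q₃ p₄ (d ^ suc q₄ ++ c ∷ Y) λ eq′ →
        <-irrefl (trans (sym (+-identityʳ q₃)) eq′) (begin-strict
          q₃          <⟨ m≤n+m (suc q₃) q₄ ⟩
          q₄ + suc q₃ ≡⟨ eq ⟩
          q₂          <⟨ s≤s (m≤m+n q₂ q₁) ⟩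
          suc q₂ + q₁ ∎)
    where open ≤-Reasoning

-- Cutting a word into runs

otherLetter : {c d x : Letter} → c ≢ d → c ≢ x → x ≡ d
otherLetter {a} {a}     c≢d c≢x = contradiction refl c≢d
otherLetter {a} {b} {a} c≢d c≢x = contradiction refl c≢x
otherLetter {a} {b} {b} c≢d c≢x = refl
otherLetter {b} {a} {a} c≢d c≢x = refl
otherLetter {b} {a} {b} c≢d c≢x = contradiction refl c≢x
otherLetter {b} {b}     c≢d c≢x = contradiction refl c≢d

-- `runsAfter c w` counts the runs of `c ∷ w`, so `p` omits the leading `c`, and `d` becomes the
-- leading letter for `w′`.
splitRun : ∀ {c d} → c ≢ d → ∀ n w → 2 + n ≤ runsAfter c w →
  ∃₂ λ p w′ → w ≡ c ^ p ++ d ∷ w′ × suc n ≤ runsAfter d w′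
splitRun c≢d n [] (s≤s ())
splitRun {c} c≢d n (y ∷ w) le with c ≟L y
... | yes refl = let p , w′ , eq , le′ = splitRun c≢d n w le in suc p , w′ , cong (c ∷_) eq , le′
... | no c≢y with refl ← otherLetter c≢d c≢y = 0 , w , refl , s≤s⁻¹ le

nineRuns⇒defectiveBR : ∀ {c d} → c ≢ d → ∀ w → 9 ≤ runsAfter c w → HasDefectiveBR (c ∷ w)
nineRuns⇒defectiveBR {c} {d} c≢d w le₀
  -- Nine runs have eight boundaries; `Y` is all that follows the first letter of the ninth run.
  with p₁ , w₁ , refl , le₁ ← splitRun c≢d 7 w le₀
  with q₁ , w₂ , refl , le₂ ← splitRun (≢-sym c≢d) 6 w₁ le₁
  with p₂ , w₃ , refl , le₃ ← splitRun c≢d 5 w₂ le₂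
  with q₂ , w₄ , refl , le₄ ← splitRun (≢-sym c≢d) 4 w₃ le₃
  with p₃ , w₅ , refl , le₅ ← splitRun c≢d 3 w₄ le₄
  with q₃ , w₆ , refl , le₆ ← splitRun (≢-sym c≢d) 2 w₅ le₅
  with p₄ , w₇ , refl , le₇ ← splitRun c≢d 1 w₆ le₆
  with q₄ , Y , refl , _ ← splitRun (≢-sym c≢d) 0 w₇ le₇
  -- The leading `c` trades places with `c ^ p₁`, so the pattern starts at the last letter of the
  -- first run.
  = subst HasDefectiveBR (^-shift c p₁)
      (Alternating.defectiveBR-nineRuns c d c≢d (c ^ p₁) q₁ p₂ q₂ p₃ q₃ p₄ q₄ Y)

nineRuns⇒¬allRich : ∀ w → 9 ≤ runLength w → ¬ (∀ v → InBR w v → Rich v)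
nineRuns⇒¬allRich w le rich = let v , br , def = defectiveBR w le in defective⇒¬rich def (rich v br)
  where
  defectiveBR : ∀ w → 9 ≤ runLength w → HasDefectiveBR w
  defectiveBR (a ∷ w) = nineRuns⇒defectiveBR {d = b} (λ ()) w
  defectiveBR (b ∷ w) = nineRuns⇒defectiveBR {d = a} (λ ()) w

-- At least two runs

runsAfter-positive : ∀ x w → 1 ≤ runsAfter x w
runsAfter-positive x [] = ≤-refl
runsAfter-positive x (y ∷ w) with x ≟L y
... | yes _ = runsAfter-positive y w
... | no  _ = s≤s z≤n

twoLetters⇒twoRuns : ∀ {x y} w → x ≢ y → y ∈ w → 2 ≤ runsAfter x w
twoLetters⇒twoRuns {x} (z ∷ w) x≢y y∈ with x ≟L z
... | no _ = s≤s (runsAfter-positive z w)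
twoLetters⇒twoRuns (z ∷ w) x≢y (here refl) | yes refl = contradiction refl x≢y
twoLetters⇒twoRuns (z ∷ w) x≢y (there y∈) | yes refl = twoLetters⇒twoRuns w x≢y y∈

binary⇒twoRuns : ∀ w → Binary w → 2 ≤ runLength w
binary⇒twoRuns (a ∷ w) (_ , there b∈w) = twoLetters⇒twoRuns w (λ ()) b∈w
binary⇒twoRuns (b ∷ w) (there a∈w , _) = twoLetters⇒twoRuns w (λ ()) a∈w

theorem4p7 : (w : Word) → Binary w → (∀ v → InBR w v → Rich v) →
    (2 ≤ runLength w) × (runLength w ≤ 8)
theorem4p7 w binary rich =
  binary⇒twoRuns w binary , ≮⇒≥ λ 9≤runs → nineRuns⇒¬allRich w 9≤runs rich
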